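{- Consider DIVIDING. For all $n\in \mathbb{N}$, $\mathcal{SG}(n)=\Omega_2(n)$.
   Context: DIVIDING is the impartial normal-play game on positive integers (heaps) where a move replaces a heap $n$ by $m\ge 2$ equal heaps $k$ with $km=n$, the resulting heaps being played as a disjunctive sum; a heap of size $1$ is terminal. $\mathcal{SG}$ denotes the Sprague-Grundy value (mex rule; nim-sum for disjunctive sums). $\Omega_2(n)$ is the number of prime factors of $n$ where the odd primes are counted with multiplicity and the prime $2$ is counted without multiplicity (i.e. at most once). -}

module Defs where

open import Data.Bool.Base using (if_then_else_)
open import Data.Fin.Base using (Fin; toℕ; fromℕ<)
open import Data.Fin.Properties using (toℕ<n; toℕ-fromℕ<)
open import Data.List.Base using (List; []; _∷_; _++_; map; filter; length; upTo; allFin; cartesianProduct)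
open import Data.List.Extrema.Nat using (max; xs≤max)
open import Data.List.Membership.Propositional using (_∈_; _∉_)
open import Data.List.Membership.Propositional.Properties using (∈-filter⁺; ∈-filter⁻; ∈-cartesianProduct⁺; ∈-allFin; ∈-upTo⁺)
open import Data.List.Membership.DecPropositional using () renaming (_∈?_ to member?)
import Data.List.Relation.Unary.All as All
open import Data.Nat.Base using (ℕ; zero; suc; _+_; _*_; _⊓_; _≤_; _<_; s≤s; NonZero)
open import Data.Nat.Induction using (<-wellFounded)
open import Data.Nat.Primality.Factorisation using (factorise; factors)
open import Data.Nat.Properties using (_≟_; _≤?_; ≤-refl; m<m*n; m≤n*m; m*n≢0⇒m≢0; +-suc; +-identityʳ; <⇒≱; ≤∧≢⇒<; m<1+n⇒m≤n)
open import Data.Product.Base using (_×_; _,_; proj₂; ∃-syntax)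
open import Induction.WellFounded using (Acc; acc)
open import Relation.Binary.PropositionalEquality using (_≡_; refl; sym; cong; subst)
open import Relation.Nullary.Decidable using (Dec; yes; no; does; ¬?; _×-dec_)

-- A (short) impartial game is given by the finite list of its options; the
-- order and multiplicity of the options are irrelevant to SG.
data Game : Set where
  node : List Game → Game

terminal : Game
terminal = node []

-- Disjunctive sum: a move is a move in exactly one of the two components.
infixl 6 _⊕_

mutual
  _⊕_ : Game → Game → Game
  G@(node gs) ⊕ H@(node hs) = node (movesInLeft gs H ++ movesInRight G hs)

  movesInLeft : List Game → Game → List Game
  movesInLeft []       H = []
  movesInLeft (g ∷ gs) H = (g ⊕ H) ∷ movesInLeft gs H

  movesInRight : Game → List Game → List Game
  movesInRight G []       = []
  movesInRight G (h ∷ hs) = (G ⊕ h) ∷ movesInRight G hs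

copies : ℕ → Game → Game
copies zero    G = terminal
copies (suc m) G = G ⊕ copies m G

infix 4 _∈?_
_∈?_ : (v : ℕ) (xs : List ℕ) → Dec (v ∈ xs)
_∈?_ = member? _≟_

-- Linear search upwards from v; the first argument bounds the number of steps.
mexFrom : ℕ → ℕ → List ℕ → ℕ
mexFrom zero       v xs = v
mexFrom (suc fuel) v xs = if does (v ∈? xs) then mexFrom fuel (suc v) xs else v

-- The least natural number not in xs, see mex-∉ and <mex⇒∈.
mex : List ℕ → ℕ
mex xs = mexFrom (suc (max 0 xs)) 0 xs

mutual
  SG : Game → ℕ
  SG (node gs) = mex (SGs gs)

  SGs : List Game → List ℕ
  SGs []       = []
  SGs (g ∷ gs) = SG g ∷ SGs gs

-- The moves of DIVIDING from a heap n ≥ 1: (k , m) replaces n by m heaps k.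
-- The bounds k < n and m ≤ n on the search exclude no move, see ∈-moves⁺.
moves : (n : ℕ) → List (Fin n × ℕ)
moves n = filter (λ (k , m) → (2 ≤? m) ×-dec (toℕ k * m ≟ n))
                 (cartesianProduct (allFin n) (upTo (suc n)))

heapAcc : (n : ℕ) → Acc _<_ n → Game
heapAcc n (acc rs) =
  node (map (λ (k , m) → copies m (heapAcc (toℕ k) (rs (toℕ<n k)))) (moves n))

-- DIVIDING played on a single heap. Only n ≥ 1 is meaningful: heap 0 has no
-- options, and it is not reachable from any other heap.
heap : ℕ → Game
heap n = heapAcc n (<-wellFounded n)

Ω₂ : (n : ℕ) → .{{NonZero n}} → ℕ
Ω₂ n = length (filter (λ p → ¬? (p ≟ 2)) ps) + (1 ⊓ length (filter (_≟ 2) ps))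
  where
  ps : List ℕ
  ps = factors (factorise n)

mexFrom-∉ : ∀ fuel v xs → (∀ {x} → x ∈ xs → x < fuel + v) → mexFrom fuel v xs ∉ xs
mexFrom-∉ zero       v xs bound v∈xs = <⇒≱ (bound v∈xs) ≤-refl
mexFrom-∉ (suc fuel) v xs bound with v ∈? xs
... | yes _   = mexFrom-∉ fuel (suc v) xs (λ {x} x∈xs → subst (x <_) (sym (+-suc fuel v)) (bound x∈xs))
... | no v∉xs = v∉xs

<mexFrom⇒∈ : ∀ fuel v xs → (∀ {u} → u < v → u ∈ xs) → ∀ {u} → u < mexFrom fuel v xs → u ∈ xs
<mexFrom⇒∈ zero       v xs below = below
<mexFrom⇒∈ (suc fuel) v xs below with v ∈? xs
... | no  _    = below
... | yes v∈xs = <mexFrom⇒∈ fuel (suc v) xs below′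
  where
  below′ : ∀ {u} → u < suc v → u ∈ xs
  below′ {u} u<1+v with u ≟ v
  ... | yes refl = v∈xs
  ... | no u≢v   = below (≤∧≢⇒< (m<1+n⇒m≤n u<1+v) u≢v)

mex-∉ : ∀ xs → mex xs ∉ xs
mex-∉ xs = mexFrom-∉ (suc (max 0 xs)) 0 xs
  (λ {x} x∈xs → subst (x <_) (sym (+-identityʳ _)) (s≤s (All.lookup (xs≤max 0 xs) x∈xs)))

<mex⇒∈ : ∀ xs {u} → u < mex xs → u ∈ xs
<mex⇒∈ xs = <mexFrom⇒∈ (suc (max 0 xs)) 0 xs (λ ())

∈-moves⁻ : ∀ {n} {k : Fin n} {m} → (k , m) ∈ moves n → 2 ≤ m × toℕ k * m ≡ n
∈-moves⁻ {n} k,m∈ = proj₂ (∈-filter⁻ (λ (k , m) → (2 ≤? m) ×-dec (toℕ k * m ≟ n))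
  {xs = cartesianProduct (allFin n) (upTo (suc n))} k,m∈)

∈-moves⁺ : ∀ {n} .{{_ : NonZero n}} {k m} → 2 ≤ m → k * m ≡ n →
           ∃[ i ] toℕ i ≡ k × (i , m) ∈ moves n
∈-moves⁺ {n} {k = k} {m} 2≤m refl =
  fromℕ< k<n , toℕ-fromℕ< k<n ,
  ∈-filter⁺ (λ (k′ , m′) → (2 ≤? m′) ×-dec (toℕ k′ * m′ ≟ k * m))
    (∈-cartesianProduct⁺ (∈-allFin (fromℕ< k<n)) (∈-upTo⁺ (s≤s (m≤n*m m k))))
    (2≤m , cong (_* m) (toℕ-fromℕ< k<n))
  where
  instance
    k≢0 : NonZero k
    k≢0 = m*n≢0⇒m≢0 k
  k<n : k < k * m
  k<n = m<m*n k m 2≤m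

{-# OPTIONS --safe #-}

-- Since G ⊕ G cancels inside any sum, m equal heaps k have value 0 if m is even
-- and SG(k) if m is odd. By induction the options of n therefore have value 0
-- (available through an even m exactly when n is even) or Ω₂(k) with n/k > 1
-- odd. Passing to such a k removes a non-empty choice of odd prime factors and
-- keeps the power of 2, so these values are exactly those from [2 ∣ n] up to
-- Ω₂(n) − 1; the mex of all of them is Ω₂(n).
module Submission where

open import Data.Bool.Base using (true; false; if_then_else_)
open import Data.Fin.Base using (toℕ)
open import Data.Fin.Properties using (toℕ<n)
open import Data.List.Base using (List; []; _∷_; _++_; map; filter; length; take; drop)
open import Data.List.Membership.Propositional using (_∈_)
open import Data.List.Membership.Propositional.Properties using (∈-map⁺; ∈-map⁻; ∈-++⁺ˡ; ∈-++⁺ʳ; ∈-++⁻; ∈-filter⁺; ∈-length)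
open import Data.List.Properties using (filter-++; filter-all; filter-none; length-++; length-take; length-drop; take++drop≡id; ++-identityʳ)
open import Data.List.Relation.Binary.Permutation.Propositional using (_↭_)
open import Data.List.Relation.Binary.Permutation.Propositional.Properties using (filter-↭; ↭-length)
open import Data.List.Relation.Unary.All as All using (All; []; _∷_)
import Data.List.Relation.Unary.All.Properties as All
open import Data.Nat.Base using (ℕ; zero; suc; _+_; _*_; _∸_; _⊓_; _≤_; _<_; z≤n; s≤s; z<s; NonZero; ≢-nonZero; ≢-nonZero⁻¹; >-nonZero; nonTrivial⇒n>1)
open import Data.Nat.Divisibility using (_∣_; _∤_; _∣?_; ∣m+n∣m⇒∣n; ∣m∣n⇒∣m+n; ∣-refl; ∣-trans; ∣⇒≤; m∣m*n; n∣m*n; _∣0)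
open import Data.Nat.Induction using (<-wellFounded)
open import Data.Nat.ListAction using (product)
open import Data.Nat.ListAction.Properties using (product-++; product≢0; ∈⇒∣product)
open import Data.Nat.Primality using (Prime; prime[2]; prime⇒nonZero; prime⇒nonTrivial)
open import Data.Nat.Primality.Factorisation using (PrimeFactorisation; factorise; factorisationUnique; factorisationHasAllPrimeFactors)
open import Data.Nat.Properties
open import Data.Product.Base using (Σ-syntax; ∃-syntax; _×_; _,_)
open import Data.Sum.Base using (_⊎_; inj₁; inj₂)
open import Function.Base using (_∘_)
open import Induction.WellFounded using (Acc; acc)
open import Relation.Binary.Definitions using (tri<; tri≈; tri>)
open import Relation.Binary.PropositionalEquality using (_≡_; _≢_; refl; sym; trans; cong; cong₂; subst; module ≡-Reasoning)
open import Relation.Nullary.Decidable using (yes; no; does; ¬?; dec-true; dec-false)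
open import Relation.Nullary.Negation using (¬_; contradiction)
open import Defs

-- Grundy values of games

options : Game → List Game
options (node gs) = gs

mutual
  -- Options sit inside a list, so the companion on lists of games keeps the recursion structural.
  Game-induction : ∀ {ℓ} (P : Game → Set ℓ) →
                   (∀ G → (∀ {g} → g ∈ options G → P g) → P G) → ∀ G → P G
  Game-induction P step (node gs) = step (node gs) (All.lookup (Games-induction P step gs))

  Games-induction : ∀ {ℓ} (P : Game → Set ℓ) →
                    (∀ G → (∀ {g} → g ∈ options G → P g) → P G) → ∀ gs → All P gs
  Games-induction P step []       = []
  Games-induction P step (g ∷ gs) = Game-induction P step g ∷ Games-induction P step gs

mex-unique : ∀ xs {v} → ¬ v ∈ xs → (∀ {u} → u < v → u ∈ xs) → mex xs ≡ v
mex-unique xs {v} v∉xs below with <-cmp (mex xs) v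
... | tri< mex<v _ _ = contradiction (below mex<v) (mex-∉ xs)
... | tri≈ _ mex≡v _ = mex≡v
... | tri> _ _ v<mex = contradiction (<mex⇒∈ xs v<mex) v∉xs

SGs≡map : ∀ gs → SGs gs ≡ map SG gs
SGs≡map []       = refl
SGs≡map (g ∷ gs) = cong (SG g ∷_) (SGs≡map gs)

SG≡mex : ∀ G → SG G ≡ mex (map SG (options G))
SG≡mex (node gs) = cong mex (SGs≡map gs)

SG-option≢ : ∀ G {g} → g ∈ options G → SG g ≢ SG G
SG-option≢ G g∈ SGg≡ =
  mex-∉ (map SG (options G)) (subst (_∈ _) (trans SGg≡ (SG≡mex G)) (∈-map⁺ SG g∈))

<SG⇒option : ∀ G {u} → u < SG G → ∃[ g ] g ∈ options G × u ≡ SG g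
<SG⇒option G u< = ∈-map⁻ SG (<mex⇒∈ (map SG (options G)) (subst (_ <_) (SG≡mex G) u<))

-- The mex rule in terms of moves. Every later computation of a Grundy value by induction supplies
-- these two conditions, `avoids` and `below`.
SG-unique : ∀ G {v} → (∀ {g} → g ∈ options G → SG g ≢ v) →
            (∀ {u} → u < v → ∃[ g ] g ∈ options G × u ≡ SG g) → SG G ≡ v
SG-unique G {v} avoids below = trans (SG≡mex G) (mex-unique _ v∉ below′)
  where
  v∉ : ¬ v ∈ map SG (options G)
  v∉ v∈ with _ , g∈ , v≡ ← ∈-map⁻ SG v∈ = avoids g∈ (sym v≡)

  below′ : ∀ {u} → u < v → u ∈ map SG (options G)
  below′ u<v with _ , g∈ , refl ← below u<v = ∈-map⁺ SG g∈

-- Disjunctive sums and sums of equal games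

movesInLeft≡map : ∀ gs H → movesInLeft gs H ≡ map (_⊕ H) gs
movesInLeft≡map []       H = refl
movesInLeft≡map (g ∷ gs) H = cong (g ⊕ H ∷_) (movesInLeft≡map gs H)

movesInRight≡map : ∀ G hs → movesInRight G hs ≡ map (G ⊕_) hs
movesInRight≡map G []       = refl
movesInRight≡map G (h ∷ hs) = cong (G ⊕ h ∷_) (movesInRight≡map G hs)

options-⊕ : ∀ G H → options (G ⊕ H) ≡ map (_⊕ H) (options G) ++ map (G ⊕_) (options H)
options-⊕ G@(node gs) H@(node hs) = cong₂ _++_ (movesInLeft≡map gs H) (movesInRight≡map G hs)

∈-options-⊕⁺ˡ : ∀ G H {g} → g ∈ options G → g ⊕ H ∈ options (G ⊕ H)
∈-options-⊕⁺ˡ G H g∈ = subst (_ ∈_) (sym (options-⊕ G H)) (∈-++⁺ˡ (∈-map⁺ (_⊕ H) g∈))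

∈-options-⊕⁺ʳ : ∀ G H {h} → h ∈ options H → G ⊕ h ∈ options (G ⊕ H)
∈-options-⊕⁺ʳ G H h∈ =
  subst (_ ∈_) (sym (options-⊕ G H)) (∈-++⁺ʳ (map (_⊕ H) (options G)) (∈-map⁺ (G ⊕_) h∈))

∈-options-⊕⁻ : ∀ G H {x} → x ∈ options (G ⊕ H) →
               (∃[ g ] g ∈ options G × x ≡ g ⊕ H) ⊎ (∃[ h ] h ∈ options H × x ≡ G ⊕ h)
∈-options-⊕⁻ G H x∈ with ∈-++⁻ (map (_⊕ H) (options G)) (subst (_ ∈_) (options-⊕ G H) x∈)
... | inj₁ x∈ˡ = inj₁ (∈-map⁻ (_⊕ H) x∈ˡ)
... | inj₂ x∈ʳ = inj₂ (∈-map⁻ (G ⊕_) x∈ʳ)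

SG-⊕-terminal : ∀ G → SG (G ⊕ terminal) ≡ SG G
SG-⊕-terminal = Game-induction _ step
  where
  step : ∀ G → (∀ {g} → g ∈ options G → SG (g ⊕ terminal) ≡ SG g) → SG (G ⊕ terminal) ≡ SG G
  step G ih = SG-unique (G ⊕ terminal) avoids below
    where
    avoids : ∀ {x} → x ∈ options (G ⊕ terminal) → SG x ≢ SG G
    avoids x∈ x≡ with ∈-options-⊕⁻ G terminal x∈
    -- A move in the right summand is impossible, as `terminal` has no options.
    ... | inj₁ (_ , g∈ , refl) = SG-option≢ G g∈ (trans (sym (ih g∈)) x≡)

    below : ∀ {u} → u < SG G → ∃[ x ] x ∈ options (G ⊕ terminal) × u ≡ SG x
    below u< with g , g∈ , refl ← <SG⇒option G u< =
      g ⊕ terminal , ∈-options-⊕⁺ˡ G terminal g∈ , sym (ih g∈)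

-- An option of G ⊕ (G ⊕ H) moving one copy of G to g is answered by moving the
-- other copy to g, which yields value SG H; so that option cannot have value SG H.
SG-⊕-cancel : ∀ G H → SG (G ⊕ (G ⊕ H)) ≡ SG H
SG-⊕-cancel = Game-induction _ λ G ihG → Game-induction _ λ H ihH → step G H ihG ihH
  where
  -- `ihG` ranges over all second summands because the inner induction varies `H` while `G` stays
  -- fixed.
  step : ∀ G H → (∀ {g} → g ∈ options G → ∀ H → SG (g ⊕ (g ⊕ H)) ≡ SG H) →
         (∀ {h} → h ∈ options H → SG (G ⊕ (G ⊕ h)) ≡ SG h) → SG (G ⊕ (G ⊕ H)) ≡ SG H
  step G H ihG ihH = SG-unique (G ⊕ (G ⊕ H)) avoids below
    where
    avoids : ∀ {x} → x ∈ options (G ⊕ (G ⊕ H)) → SG x ≢ SG H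
    avoids x∈ x≡ with ∈-options-⊕⁻ G (G ⊕ H) x∈
    ... | inj₁ (g , g∈ , refl) =
      SG-option≢ (g ⊕ (G ⊕ H)) (∈-options-⊕⁺ʳ g (G ⊕ H) (∈-options-⊕⁺ˡ G H g∈)) (trans (ihG g∈ H) (sym x≡))
    ... | inj₂ (_ , y∈ , refl) with ∈-options-⊕⁻ G H y∈
    ...   | inj₁ (g , g∈ , refl) =
      SG-option≢ (G ⊕ (g ⊕ H)) (∈-options-⊕⁺ˡ G (g ⊕ H) g∈) (trans (ihG g∈ H) (sym x≡))
    ...   | inj₂ (h , h∈ , refl) = SG-option≢ H h∈ (trans (sym (ihH h∈)) x≡)

    below : ∀ {u} → u < SG H → ∃[ x ] x ∈ options (G ⊕ (G ⊕ H)) × u ≡ SG x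
    below u< with h , h∈ , refl ← <SG⇒option H u< =
      G ⊕ (G ⊕ h) , ∈-options-⊕⁺ʳ G (G ⊕ H) (∈-options-⊕⁺ʳ G H h∈) , sym (ihH h∈)

SG-copies-even : ∀ m G → 2 ∣ m → SG (copies m G) ≡ 0
SG-copies-even zero          G 2∣m = refl
SG-copies-even (suc zero)    G 2∣1 = contradiction (∣⇒≤ 2∣1) λ { (s≤s ()) }
SG-copies-even (suc (suc m)) G 2∣m =
  trans (SG-⊕-cancel G (copies m G)) (SG-copies-even m G (∣m+n∣m⇒∣n 2∣m ∣-refl))

SG-copies-odd : ∀ m G → 2 ∤ m → SG (copies m G) ≡ SG G
SG-copies-odd zero          G 2∤m = contradiction (2 ∣0) 2∤m
SG-copies-odd (suc zero)    G 2∤m = SG-⊕-terminal G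
SG-copies-odd (suc (suc m)) G 2∤m =
  trans (SG-⊕-cancel G (copies m G)) (SG-copies-odd m G (2∤m ∘ ∣m∣n⇒∣m+n ∣-refl))

SG-copies : ∀ m G → SG (copies m G) ≡ (if does (2 ∣? m) then 0 else SG G)
SG-copies m G with 2 ∣? m
... | yes 2∣m rewrite dec-true (2 ∣? m) 2∣m = SG-copies-even m G 2∣m
... | no  2∤m rewrite dec-false (2 ∣? m) 2∤m = SG-copies-odd m G 2∤m

-- Counting prime factors

odds twos : List ℕ → List ℕ
odds = filter (λ p → ¬? (p ≟ 2))
twos = filter (_≟ 2)

-- The formula of `Ω₂` on an arbitrary list, so that it can be evaluated on any prime factorisation
-- and not only on the one returned by `factorise`.
weight : List ℕ → ℕ
weight ps = length (odds ps) + (1 ⊓ length (twos ps))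

weight-↭ : ∀ {ps qs} → ps ↭ qs → weight ps ≡ weight qs
weight-↭ ps↭qs = cong₂ (λ a b → a + (1 ⊓ b))
  (↭-length (filter-↭ (λ p → ¬? (p ≟ 2)) ps↭qs)) (↭-length (filter-↭ (_≟ 2) ps↭qs))

-- Entries other than 2 all survive `odds` and all vanish from `twos`, so the capped term does not
-- change.
weight-++-odd : ∀ ps {qs} → All (_≢ 2) qs → weight (ps ++ qs) ≡ length qs + weight ps
weight-++-odd ps {qs} qs-odd = begin
  length (odds (ps ++ qs)) + (1 ⊓ length (twos (ps ++ qs)))
    ≡⟨ cong₂ (λ os ts → length os + (1 ⊓ length ts)) odds≡ twos≡ ⟩
  length (odds ps ++ qs) + (1 ⊓ length (twos ps))
    ≡⟨ cong (_+ (1 ⊓ length (twos ps))) (trans (length-++ (odds ps)) (+-comm (length (odds ps)) _)) ⟩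
  length qs + length (odds ps) + (1 ⊓ length (twos ps))
    ≡⟨ +-assoc (length qs) _ _ ⟩
  length qs + weight ps ∎
  where
  open ≡-Reasoning
  odds≡ : odds (ps ++ qs) ≡ odds ps ++ qs
  odds≡ = trans (filter-++ _ ps qs) (cong (odds ps ++_) (filter-all _ qs-odd))
  twos≡ : twos (ps ++ qs) ≡ twos ps
  twos≡ = trans (filter-++ _ ps qs)
                (trans (cong (twos ps ++_) (filter-none _ qs-odd)) (++-identityʳ _))

weight-twos : ∀ {ps} → All (_≡ 2) ps → weight ps ≡ 1 ⊓ length ps
weight-twos ps-two = cong₂ (λ os ts → length os + (1 ⊓ length ts))
  (filter-none _ (All.map (λ p≡2 p≢2 → p≢2 p≡2) ps-two)) (filter-all _ ps-two)

product-twos-odds : ∀ ps → product (twos ps) * product (odds ps) ≡ product ps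
product-twos-odds [] = refl
product-twos-odds (p ∷ ps) with does (p ≟ 2)
... | true = trans (*-assoc p (product (twos ps)) (product (odds ps))) (cong (p *_) (product-twos-odds ps))
... | false = begin
  product (twos ps) * (p * product (odds ps)) ≡⟨ *-assoc (product (twos ps)) p _ ⟨
  product (twos ps) * p * product (odds ps)   ≡⟨ cong (_* product (odds ps)) (*-comm (product (twos ps)) p) ⟩
  p * product (twos ps) * product (odds ps)   ≡⟨ *-assoc p (product (twos ps)) _ ⟩
  p * (product (twos ps) * product (odds ps)) ≡⟨ cong (p *_) (product-twos-odds ps) ⟩
  p * product ps                              ∎
  where open ≡-Reasoning

productOfPrimes-nonZero : ∀ {ps} → All Prime ps → NonZero (product ps)
productOfPrimes-nonZero = product≢0 ∘ All.map prime⇒nonZero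

-- Unique factorisation makes `ps` a permutation of the chosen factors, and `weight` is invariant
-- under permutations.
Ω₂≡weight : ∀ {n} .{{_ : NonZero n}} {ps} → product ps ≡ n → All Prime ps → Ω₂ n ≡ weight ps
Ω₂≡weight {n} Πps≡n primes = weight-↭ (factorisationUnique (factorise n) (record
  { factors = _ ; isFactorisation = sym Πps≡n ; factorsPrime = primes }))

private
  module F n .{{_ : NonZero n}} = PrimeFactorisation (factorise n)

2∣⇒Ω₂>0 : ∀ {n} .{{_ : NonZero n}} → 2 ∣ n → 0 < Ω₂ n
2∣⇒Ω₂>0 {n} 2∣n = <-≤-trans (⊓-pres-m< {m = 0} z<s (∈-length 2∈twos)) (m≤n+m _ _)
  where
  2∈twos : 2 ∈ twos (F.factors n)
  2∈twos = ∈-filter⁺ (_≟ 2) (factorisationHasAllPrimeFactors prime[2]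
    (subst (2 ∣_) (F.isFactorisation n) 2∣n) (F.factorsPrime n)) refl

-- Joining factorisations of `k` and `m` factorises `n`. The factors of `m` are odd, so each adds 1,
-- and there is at least one because `m` exceeds the empty product 1.
oddMultiple⇒Ω₂< : ∀ {k m n} .{{_ : NonZero k}} .{{_ : NonZero n}} →
           2 ≤ m → 2 ∤ m → k * m ≡ n → Ω₂ k < Ω₂ n
oddMultiple⇒Ω₂< {k} {m} {n} 2≤m 2∤m km≡n = begin-strict
  Ω₂ k                                  <⟨ m<n+m (Ω₂ k) length>0 ⟩
  length qs + Ω₂ k                      ≡⟨ weight-++-odd (F.factors k) qs-odd ⟨
  weight (F.factors k ++ qs)            ≡⟨ Ω₂≡weight Π≡n (All.++⁺ (F.factorsPrime k) (F.factorsPrime m)) ⟨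
  Ω₂ n                                  ∎
  where
  open ≤-Reasoning
  instance
    m≢0 : NonZero m
    m≢0 = >-nonZero (≤-trans (s≤s z≤n) 2≤m)
  qs : List ℕ
  qs = F.factors m
  qs-odd : All (_≢ 2) qs
  qs-odd = All.tabulate λ { q∈ refl → 2∤m (subst (2 ∣_) (sym (F.isFactorisation m)) (∈⇒∣product q∈)) }
  Π≡n : product (F.factors k ++ qs) ≡ n
  Π≡n = trans (product-++ (F.factors k) qs)
    (trans (sym (cong₂ _*_ (F.isFactorisation k) (F.isFactorisation m))) km≡n)
  nonEmpty : ∀ ps → 2 ≤ product ps → 0 < length ps
  nonEmpty []       (s≤s ())
  nonEmpty (_ ∷ ps) _ = z<s
  length>0 : 0 < length qs
  length>0 = nonEmpty qs (subst (2 ≤_) (F.isFactorisation m) 2≤m)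

-- The values of the options of a heap

-- The Grundy value of `m` heaps `k`, granted the theorem for `k`. This leaves a purely arithmetical
-- problem.
optionValue : (k m : ℕ) .{{_ : NonZero k}} → ℕ
optionValue k m = if does (2 ∣? m) then 0 else Ω₂ k

optionValue-even : ∀ {k m} .{{_ : NonZero k}} → 2 ∣ m → optionValue k m ≡ 0
optionValue-even {m = m} 2∣m rewrite dec-true (2 ∣? m) 2∣m = refl

optionValue-odd : ∀ {k m} .{{_ : NonZero k}} → 2 ∤ m → optionValue k m ≡ Ω₂ k
optionValue-odd {m = m} 2∤m rewrite dec-false (2 ∣? m) 2∤m = refl

-- For even `m` the value is 0 while `n` is even and so has positive `Ω₂`; for odd `m` the value
-- drops strictly.
optionValue≢Ω₂ : ∀ {k m n} .{{_ : NonZero k}} .{{_ : NonZero n}} →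
                 2 ≤ m → k * m ≡ n → optionValue k m ≢ Ω₂ n
optionValue≢Ω₂ {k} {m} 2≤m km≡n eq with 2 ∣? m
... | yes 2∣m = <⇒≢ (2∣⇒Ω₂>0 (subst (2 ∣_) km≡n (∣-trans 2∣m (n∣m*n k))))
                    (trans (sym (optionValue-even {k} 2∣m)) eq)
... | no  2∤m = <⇒≢ (oddMultiple⇒Ω₂< 2≤m 2∤m km≡n) (trans (sym (optionValue-odd 2∤m)) eq)

-- The prime 2 contributes 0 or 1 to `Ω₂ n`. A value below this contribution comes from an even
-- split; any other comes from keeping all twos and the right number of odd primes in `k`.
<Ω₂⇒optionValue : ∀ {n} .{{_ : NonZero n}} {u} → u < Ω₂ n →
  ∃[ k ] ∃[ m ] Σ[ k≢0 ∈ NonZero k ] 2 ≤ m × k * m ≡ n × u ≡ optionValue k m {{k≢0}}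
<Ω₂⇒optionValue {n} {u} u<Ω₂ with u <? 1 ⊓ length (twos (F.factors n))
-- Here `u` is 0 and `n` is even: split `n` into `n` heaps of size 1.
... | yes u<b = 1 , n , _ , ∣⇒≤ 2∣n , *-identityˡ n ,
                trans (n<1⇒n≡0 (<-≤-trans u<b (m⊓n≤m 1 _))) (sym (optionValue-even {1} 2∣n))
  where
  2∣productOfTwos : ∀ {ps} → All (_≡ 2) ps → u < 1 ⊓ length ps → 2 ∣ product ps
  2∣productOfTwos {[]}     []         ()
  2∣productOfTwos {_ ∷ ps} (refl ∷ _) _ = m∣m*n (product ps)

  2∣n : 2 ∣ n
  2∣n = ∣-trans (2∣productOfTwos (All.all-filter (_≟ 2) (F.factors n)) u<b)
        (subst (product (twos (F.factors n)) ∣_)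
          (trans (product-twos-odds (F.factors n)) (sym (F.isFactorisation n)))
          (m∣m*n (product (odds (F.factors n)))))
... | no u≮b = product ks , product ms , k≢0 , 2≤m , km≡n ,
               sym (trans (optionValue-odd {{k≢0}} 2∤m) Ω₂k≡u)
  where
  ps os ts ks ms : List ℕ
  ps = F.factors n
  os = odds ps
  ts = twos ps
  b i : ℕ
  b = 1 ⊓ length ts
  -- The number of odd primes kept in `k`; the twos account for the remaining `b`. The subtraction
  -- is exact since `b` is at most `u`.
  i = u ∸ b
  ks = ts ++ take i os
  ms = drop i os

  i+b≡u : i + b ≡ u
  i+b≡u = m∸n+n≡m (≮⇒≥ u≮b)

  -- Strictness leaves at least one odd prime for `ms`, whence the number of heaps is at least 2.
  i<length : i < length os
  i<length = +-cancelʳ-< b i (length os) (subst (_< length os + b) (sym i+b≡u) u<Ω₂)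

  os-prime : All Prime os
  os-prime = All.filter⁺ _ (F.factorsPrime n)

  os-odd : All (_≢ 2) os
  os-odd = All.all-filter (λ p → ¬? (p ≟ 2)) ps

  ks-prime : All Prime ks
  ks-prime = All.++⁺ (All.filter⁺ _ (F.factorsPrime n)) (All.take⁺ i os-prime)

  k≢0 : NonZero (product ks)
  k≢0 = productOfPrimes-nonZero ks-prime

  2∤m : 2 ∤ product ms
  2∤m 2∣m = All.lookup (All.drop⁺ i os-odd)
    (factorisationHasAllPrimeFactors prime[2] 2∣m (All.drop⁺ i os-prime)) refl

  2≤productOfPrimes : ∀ {qs} → All Prime qs → 0 < length qs → 2 ≤ product qs
  2≤productOfPrimes {q ∷ qs} (q-prime ∷ qs-prime) _ =
    ≤-trans (nonTrivial⇒n>1 q {{prime⇒nonTrivial q-prime}})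
            (m≤m*n q (product qs) {{productOfPrimes-nonZero qs-prime}})

  2≤m : 2 ≤ product ms
  2≤m = 2≤productOfPrimes (All.drop⁺ i os-prime)
          (subst (0 <_) (sym (length-drop i os)) (m<n⇒0<n∸m i<length))

  open ≡-Reasoning

  km≡n : product ks * product ms ≡ n
  km≡n = begin
    product ks * product ms                       ≡⟨ cong (_* product ms) (product-++ ts (take i os)) ⟩
    product ts * product (take i os) * product ms ≡⟨ *-assoc (product ts) _ _ ⟩
    product ts * (product (take i os) * product ms) ≡⟨ cong (product ts *_) (product-++ (take i os) ms) ⟨
    product ts * product (take i os ++ ms)        ≡⟨ cong (λ qs → product ts * product qs) (take++drop≡id i os) ⟩
    product ts * product os                       ≡⟨ product-twos-odds ps ⟩
    product ps                                    ≡⟨ F.isFactorisation n ⟨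
    n                                             ∎

  Ω₂k≡u : Ω₂ (product ks) {{k≢0}} ≡ u
  Ω₂k≡u = begin
    Ω₂ (product ks) {{k≢0}}         ≡⟨ Ω₂≡weight {{k≢0}} refl ks-prime ⟩
    weight (ts ++ take i os)        ≡⟨ weight-++-odd ts (All.take⁺ i os-odd) ⟩
    length (take i os) + weight ts  ≡⟨ cong₂ _+_ (trans (length-take i os) (m≤n⇒m⊓n≡m (<⇒≤ i<length)))
                                                 (weight-twos (All.all-filter (_≟ 2) ps)) ⟩
    i + b                           ≡⟨ i+b≡u ⟩
    u                               ∎

-- Well-founded induction on the heap size

-- Stated for every accessibility proof, so that the induction hypothesis applies to the smaller
-- heaps exactly as `heapAcc` builds them.
SG-heapAcc : ∀ n .{{_ : NonZero n}} (n-acc : Acc _<_ n) → SG (heapAcc n n-acc) ≡ Ω₂ n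
SG-heapAcc n n-acc@(acc rs) = SG-unique (heapAcc n n-acc) avoids below
  where
  -- Repeats the function mapped over `moves n` in `heapAcc`, so that membership among the options
  -- can be traced to a move.
  option : _ → Game
  option (k , m) = copies m (heapAcc (toℕ k) (rs (toℕ<n k)))

  SG-option : ∀ k m .{{_ : NonZero (toℕ k)}} → SG (option (k , m)) ≡ optionValue (toℕ k) m
  SG-option k m = trans (SG-copies m _)
    (cong (if does (2 ∣? m) then 0 else_) (SG-heapAcc (toℕ k) (rs (toℕ<n k))))

  -- Heaps reached from a positive heap are positive, so the induction never meets heap 0.
  factor-nonZero : ∀ k {m} → k * m ≡ n → NonZero k
  factor-nonZero k {m} km≡n = m*n≢0⇒m≢0 k {{≢-nonZero λ km≡0 → ≢-nonZero⁻¹ n (trans (sym km≡n) km≡0)}}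

  avoids : ∀ {g} → g ∈ options (heapAcc n n-acc) → SG g ≢ Ω₂ n
  avoids g∈ SGg≡ with (k , m) , k,m∈ , refl ← ∈-map⁻ option g∈ with 2≤m , km≡n ← ∈-moves⁻ k,m∈ =
    optionValue≢Ω₂ {{k≢0}} 2≤m km≡n (trans (sym (SG-option k m {{k≢0}})) SGg≡)
    where k≢0 = factor-nonZero (toℕ k) km≡n

  below : ∀ {u} → u < Ω₂ n → ∃[ g ] g ∈ options (heapAcc n n-acc) × u ≡ SG g
  below u< with k , m , k≢0 , 2≤m , km≡n , u≡ ← <Ω₂⇒optionValue u<
           with i , refl , i,m∈ ← ∈-moves⁺ {k = k} 2≤m km≡n =
    option (i , m) , ∈-map⁺ option i,m∈ , trans u≡ (sym (SG-option i m {{k≢0}}))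

mainTheorem9 : (n : ℕ) .{{_ : NonZero n}} → SG (heap n) ≡ Ω₂ n
mainTheorem9 n = SG-heapAcc n (<-wellFounded n)
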